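{- Let $\mathsf{V}$ be a variety with the congruence extension property such that $\mathbb{HS}(\mathsf{V}_{\mathrm{FSI}})=\mathsf{V}_{\mathrm{FSI}}$. Then $\mathsf{V}$ has the amalgamation property if and only if $\mathsf{V}_{\mathrm{FSI}}$ has the essential amalgamation property.
   Context: $\mathbb{H}$ and $\mathbb{S}$ denote closure under homomorphic images and subalgebras. $\mathsf{V}_{\mathrm{FSI}}$ is the class of finitely subdirectly irreducible members of $\mathsf{V}$: those $\mathbf{A}\in\mathsf{V}$ such that whenever the least congruence of $\mathbf{A}$ is the intersection of a non-empty finite collection of congruences, it equals one of them (so trivial algebras are finitely subdirectly irreducible). A span in a class $\mathsf{K}$ is a pair of embeddings $\varphi_1\colon\mathbf{A}\to\mathbf{B}$, $\varphi_2\colon\mathbf{A}\to\mathbf{C}$ with $\mathbf{A},\mathbf{B},\mathbf{C}\in\mathsf{K}$; an amalgam of it in $\mathsf{K}$ is a pair of embeddings $\psi_1\colon\mathbf{B}\to\mathbf{D}$, $\psi_2\colon\mathbf{C}\to\mathbf{D}$ with $\mathbf{D}\in\mathsf{K}$ and $\psi_1\varphi_1=\psi_2\varphi_2$. $\mathsf{K}$ has the amalgamation property if every span in $\mathsf{K}$ has an amalgam in $\mathsf{K}$. An embedding $\varphi\colon\mathbf{A}\to\mathbf{B}$ is essential if every congruence of $\mathbf{B}$ other than the least congruence $\Delta_B$ restricts to a congruence of the subalgebra $\varphi[\mathbf{A}]$ other than the least one. A span $\langle\varphi_1,\varphi_2\rangle$ is essential if $\varphi_2$ is an essential embedding. $\mathsf{K}$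 has the essential amalgamation property if every essential span in $\mathsf{K}$ has an amalgam in $\mathsf{K}$. -}

module Defs where

open import Data.Fin.Base using (Fin)
open import Data.Nat.Base using (ℕ; suc)
open import Data.Product.Base using (Σ; Σ-syntax; ∃; ∃-syntax; _×_; _,_; proj₁; proj₂)
open import Data.Sum.Base using (_⊎_)
open import Data.Vec.Functional using (Vector)
open import Function.Base using (_∘_; _on_)
open import Function.Definitions using (Congruent; Injective; Surjective; Bijective)
open import Level using (Level; _⊔_) renaming (suc to lsuc)
open import Relation.Binary.Bundles using (Setoid; Poset)
open import Relation.Binary.Core using (Rel; _⇒_; _⇔_)
open import Relation.Binary.Definitions using (_Respects_)
open import Relation.Binary.Structures using (IsEquivalence)
open import Relation.Nullary.Negation.Core using (¬_)
open import Relation.Unary using (Pred; _∈_; _⊆_; _∩_; Satisfiable)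
import Relation.Binary.Construct.On as On

------------------------------------------------------------------------
-- Zorn's lemma, as a proposition.  The empty chain is a chain, so the
-- premise of the implication makes the poset non-empty.

module _ {a ℓ₁ ℓ₂ : Level} (P : Poset a ℓ₁ ℓ₂) where
  open Poset P

  IsChain : Pred Carrier a → Set (a ⊔ ℓ₂)
  IsChain C = ∀ {x y} → x ∈ C → y ∈ C → x ≤ y ⊎ y ≤ x

  IsUpperBound : Pred Carrier a → Pred Carrier (a ⊔ ℓ₂)
  IsUpperBound C u = ∀ {x} → x ∈ C → x ≤ u

  IsMaximal : Pred Carrier (a ⊔ ℓ₁ ⊔ ℓ₂)
  IsMaximal m = ∀ {x} → m ≤ x → x ≈ m

ZornsLemma : ∀ a ℓ₁ ℓ₂ → Set (lsuc (a ⊔ ℓ₁ ⊔ ℓ₂))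
ZornsLemma a ℓ₁ ℓ₂ =
  (P : Poset a ℓ₁ ℓ₂) →
  (∀ C → IsChain P C → ∃ (IsUpperBound P C)) →
  ∃ (IsMaximal P)

------------------------------------------------------------------------
-- Algebras.  Sets are setoids in Set ℓ, so that quotients exist: A / θ
-- is the carrier of A with θ as its equality.

record Signature (ℓ : Level) : Set (lsuc ℓ) where
  field
    Op    : Set ℓ
    arity : Op → ℕ

module _ {ℓ : Level} (𝑆 : Signature ℓ) where
  open Signature 𝑆

  -- Universes of algebras are non-empty, as is usual in universal
  -- algebra.  The inhabitant is not part of the structure: neither
  -- homomorphisms nor subalgebras have to respect it.

  record Algebra : Set (lsuc ℓ) where
    field
      setoid : Setoid ℓ ℓ
    open Setoid setoid public
    field
      op         : (f : Op) → Vector Carrier (arity f) → Carrier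
      op-cong    : ∀ f {xs ys} → (∀ i → xs i ≈ ys i) → op f xs ≈ op f ys
      inhabitant : Carrier

module _ {ℓ : Level} {𝑆 : Signature ℓ} where
  open Signature 𝑆

  record Hom (A B : Algebra 𝑆) : Set ℓ where
    private
      module A = Algebra A
      module B = Algebra B
    field
      to   : A.Carrier → B.Carrier
      cong : Congruent A._≈_ B._≈_ to
      homo : ∀ f xs → to (A.op f xs) B.≈ B.op f (to ∘ xs)

  record Embedding (A B : Algebra 𝑆) : Set ℓ where
    field
      hom : Hom A B
    open Hom hom public
    field
      injective : Injective (Algebra._≈_ A) (Algebra._≈_ B) to

  record _≅_ (A B : Algebra 𝑆) : Set ℓ where
    field
      hom : Hom A B
    open Hom hom public
    field
      bijective : Bijective (Algebra._≈_ A) (Algebra._≈_ B) to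

  ----------------------------------------------------------------------
  -- Subalgebras and products

  record Subuniverse (B : Algebra 𝑆) : Set (lsuc ℓ) where
    open Algebra B
    field
      Member   : Pred Carrier ℓ
      respects : Member Respects _≈_
      closed   : ∀ f xs → (∀ i → xs i ∈ Member) → op f xs ∈ Member
      nonempty : Satisfiable Member

  subalgebra : (B : Algebra 𝑆) → Subuniverse B → Algebra 𝑆
  subalgebra B P = record
    { setoid     = On.setoid {B = Σ Carrier Member} setoid proj₁
    ; op         = λ f xs → op f (proj₁ ∘ xs) , closed f (proj₁ ∘ xs) (proj₂ ∘ xs)
    ; op-cong    = λ f → op-cong f
    ; inhabitant = nonempty
    }
    where
    open Algebra B
    open Subuniverse P

  image : {A B : Algebra 𝑆} → Hom A B → Subuniverse B
  image {A} {B} φ = record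
    { Member   = λ b → ∃[ a ] to a ≈ b
    ; respects = λ b≈b′ (a , φa≈b) → a , trans φa≈b b≈b′
    ; closed   = λ f xs p → A.op f (proj₁ ∘ p) , trans (homo f (proj₁ ∘ p)) (op-cong f (proj₂ ∘ p))
    ; nonempty = to A.inhabitant , A.inhabitant , refl
    }
    where
    module A = Algebra A
    open Algebra B
    open Hom φ

  Π : {I : Set ℓ} → (I → Algebra 𝑆) → Algebra 𝑆
  Π {I} A = record
    { setoid = record
      { Carrier       = ∀ i → A.Carrier i
      ; _≈_           = λ x y → ∀ i → A._≈_ i (x i) (y i)
      ; isEquivalence = record
        { refl  = λ i → A.refl i
        ; sym   = λ p i → A.sym i (p i)
        ; trans = λ p q i → A.trans i (p i) (q i)
        }
      }
    ; op         = λ f xs i → A.op i f (λ k → xs k i)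
    ; op-cong    = λ f p i → A.op-cong i f (λ k → p k i)
    ; inhabitant = λ i → A.inhabitant i
    }
    where module A i = Algebra (A i)

  ----------------------------------------------------------------------
  -- Congruences

  record Congruence (A : Algebra 𝑆) : Set (lsuc ℓ) where
    open Algebra A hiding (isEquivalence)
    field
      rel           : Rel Carrier ℓ
      ≈⇒rel         : _≈_ ⇒ rel
      isEquivalence : IsEquivalence rel
      compatible    : ∀ f {xs ys} → (∀ i → rel (xs i) (ys i)) → rel (op f xs) (op f ys)

  infix 4 _≐ᶜ_

  _≐ᶜ_ : {A : Algebra 𝑆} → Rel (Congruence A) ℓ
  θ ≐ᶜ ψ = Congruence.rel θ ⇔ Congruence.rel ψ

  Δ : (A : Algebra 𝑆) → Congruence A
  Δ A = record
    { rel           = _≈_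
    ; ≈⇒rel         = λ p → p
    ; isEquivalence = isEquivalence
    ; compatible    = op-cong
    }
    where open Algebra A

  ⋂ : {A : Algebra 𝑆} {n : ℕ} → (Fin n → Congruence A) → Congruence A
  ⋂ θ = record
    { rel           = λ x y → ∀ i → θ.rel i x y
    ; ≈⇒rel         = λ p i → θ.≈⇒rel i p
    ; isEquivalence = record
      { refl  = λ i → IsEquivalence.refl (θ.isEquivalence i)
      ; sym   = λ p i → IsEquivalence.sym (θ.isEquivalence i) (p i)
      ; trans = λ p q i → IsEquivalence.trans (θ.isEquivalence i) (p i) (q i)
      }
    ; compatible    = λ f p i → θ.compatible i f (λ k → p k i)
    }
    where module θ i = Congruence (θ i)

  restrict : {B : Algebra 𝑆} (P : Subuniverse B) → Congruence B → Congruence (subalgebra B P)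
  restrict P θ = record
    { rel           = rel on proj₁
    ; ≈⇒rel         = ≈⇒rel
    ; isEquivalence = On.isEquivalence proj₁ isEquivalence
    ; compatible    = λ f → compatible f
    }
    where open Congruence θ

  IsFSI : Pred (Algebra 𝑆) (lsuc ℓ)
  IsFSI A = ∀ {n} (θ : Fin (suc n) → Congruence A) → Δ A ≐ᶜ ⋂ θ → ∃[ i ] Δ A ≐ᶜ θ i

  IsEssential : {A B : Algebra 𝑆} → Embedding A B → Set (lsuc ℓ)
  IsEssential {A} {B} φ =
    ∀ Θ → ¬ (Θ ≐ᶜ Δ B) → ¬ (restrict φ[A] Θ ≐ᶜ Δ (subalgebra B φ[A]))
    where φ[A] = image (Embedding.hom φ)

  ----------------------------------------------------------------------
  -- Classes of algebras

  module _ {k : Level} (K : Pred (Algebra 𝑆) k) where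

    ℍ : Pred (Algebra 𝑆) (lsuc ℓ ⊔ k)
    ℍ B = ∃[ A ] A ∈ K × Σ[ φ ∈ Hom A B ] Surjective (Algebra._≈_ A) (Algebra._≈_ B) (Hom.to φ)

    -- 𝕊 and ℙ are closed under isomorphism: without an equality of
    -- algebras, "being a subalgebra (product)" can only mean being
    -- isomorphic to one.

    𝕊 : Pred (Algebra 𝑆) (lsuc ℓ ⊔ k)
    𝕊 B = ∃[ A ] A ∈ K × Σ[ P ∈ Subuniverse A ] B ≅ subalgebra A P

    ℙ : Pred (Algebra 𝑆) (lsuc ℓ ⊔ k)
    ℙ B = Σ[ I ∈ Set ℓ ] Σ[ A ∈ (I → Algebra 𝑆) ] (∀ i → A i ∈ K) × B ≅ Π A

    FSI : Pred (Algebra 𝑆) (lsuc ℓ ⊔ k)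
    FSI = K ∩ IsFSI

    CongruenceExtensionProperty : Set (lsuc ℓ ⊔ k)
    CongruenceExtensionProperty =
      ∀ {B} → B ∈ K → (P : Subuniverse B) (θ : Congruence (subalgebra B P)) →
      ∃[ Θ ] restrict P Θ ≐ᶜ θ

    record Span : Set (lsuc ℓ ⊔ k) where
      field
        {A B C} : Algebra 𝑆
        A∈K     : A ∈ K
        B∈K     : B ∈ K
        C∈K     : C ∈ K
        φ₁      : Embedding A B
        φ₂      : Embedding A C

    record Amalgam (s : Span) : Set (lsuc ℓ ⊔ k) where
      open Span s
      field
        {D} : Algebra 𝑆
        D∈K : D ∈ K
        ψ₁  : Embedding B D
        ψ₂  : Embedding C D
      private
        module φ₁ = Embedding φ₁
        module φ₂ = Embedding φ₂
        module ψ₁ = Embedding ψ₁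
        module ψ₂ = Embedding ψ₂
      field
        commutes : ∀ a → Algebra._≈_ D (ψ₁.to (φ₁.to a)) (ψ₂.to (φ₂.to a))

    AmalgamationProperty : Set (lsuc ℓ ⊔ k)
    AmalgamationProperty = (s : Span) → Amalgam s

    EssentialAmalgamationProperty : Set (lsuc ℓ ⊔ k)
    EssentialAmalgamationProperty = (s : Span) → IsEssential (Span.φ₂ s) → Amalgam s

  -- The product of the empty family makes a variety non-empty.

  record IsVariety {v : Level} (V : Pred (Algebra 𝑆) v) : Set (lsuc ℓ ⊔ v) where
    field
      ℍ-closed : ℍ V ⊆ V
      𝕊-closed : 𝕊 V ⊆ V
      ℙ-closed : ℙ V ⊆ V

{-# OPTIONS --safe #-}

-- Both directions rest on one extremal choice: if φ embeds A into D and
-- Θ is maximal among the congruences of D with Θ ∩ φ[A]² equal to a given θ,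
-- then A/θ → D/Θ is essential, and an essential extension of a finitely
-- subdirectly irreducible algebra is finitely subdirectly irreducible.
--
-- (⇒) In an amalgam D in V of an essential span, take Θ maximal with
-- Θ ∩ B² = Δ.  Then D/Θ is finitely subdirectly irreducible and B embeds
-- into it; Θ ∩ C² is trivial on A, hence trivial, so C embeds as well.
--
-- (⇐) Given b ≠ b′ in B, take Θ maximal avoiding (b , b′), let θ = Θ ∩ A²,
-- and take Ψ on C maximal with Ψ ∩ A² = θ, which exists by congruence
-- extension.  The span B/Θ ← A/θ → C/Ψ is essential, and its amalgam
-- separates b from b′.  Doing the same for C, the product of all these
-- amalgams is an amalgam of the original span.

module Submission where

open import Defs
open import Axiom.ExcludedMiddle using (ExcludedMiddle)
open import Data.Empty using (⊥)
open import Data.Fin.Base using (Fin; zero; suc)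
open import Data.Nat.Base using (zero; suc)
open import Data.Product.Base using (Σ-syntax; ∃; ∃-syntax; _×_; _,_; proj₁; proj₂)
open import Data.Sum.Base using (_⊎_; inj₁; inj₂)
open import Function.Base using (_∘_; id)
open import Function.Bundles using (_⇔_; mk⇔)
open import Level using (Level; _⊔_; Lift; lift) renaming (suc to lsuc)
open import Relation.Binary.Bundles using (Poset)
open import Relation.Binary.Core using (Rel; _⇒_)
open import Relation.Binary.PropositionalEquality.Core using (_≡_; refl)
open import Relation.Binary.Structures using (IsEquivalence)
open import Relation.Nullary.Decidable using (True; toWitness; fromWitness; decidable-stable)
open import Relation.Nullary.Negation.Core using (¬_)
open import Relation.Unary using (Pred; _∈_; _⊆_; _≐_)

module _ {ℓ : Level} {𝑆 : Signature ℓ} where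
  open Algebra using (Carrier)

  -- Quotients, pullbacks of congruences, and images.

  infix 4 _[_≈_]

  _[_≈_] : (A : Algebra 𝑆) → Rel (Carrier A) ℓ
  A [ x ≈ y ] = Algebra._≈_ A x y

  infixl 8 _/_

  _/_ : (A : Algebra 𝑆) → Congruence A → Algebra 𝑆
  A / θ = record
    { setoid     = record { isEquivalence = isEquivalence }
    ; op         = Algebra.op A
    ; op-cong    = compatible
    ; inhabitant = Algebra.inhabitant A
    }
    where open Congruence θ

  quotientMap : (A : Algebra 𝑆) (θ : Congruence A) → Hom A (A / θ)
  quotientMap A θ = record
    { to   = id
    ; cong = Congruence.≈⇒rel θ
    ; homo = λ _ _ → IsEquivalence.refl (Congruence.isEquivalence θ)
    }

  infixr 9 _∘ʰ_

  _∘ʰ_ : {A B C : Algebra 𝑆} → Hom B C → Hom A B → Hom A C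
  _∘ʰ_ {C = C} g f = record
    { to   = g.to ∘ f.to
    ; cong = g.cong ∘ f.cong
    ; homo = λ o xs → Algebra.trans C (g.cong (f.homo o xs)) (g.homo o (f.to ∘ xs))
    }
    where
    module f = Hom f
    module g = Hom g

  -- Along the quotient map, this views a congruence of A / θ as one of A.

  preimage : {A B : Algebra 𝑆} → Hom A B → Congruence B → Congruence A
  preimage {A} {B} φ Θ = record
    { rel           = λ x y → rel (to x) (to y)
    ; ≈⇒rel         = ≈⇒rel ∘ cong
    ; isEquivalence = record { refl = E.refl ; sym = E.sym ; trans = E.trans }
    ; compatible    = λ f p → E.trans (≈⇒rel (homo f _))
        (E.trans (compatible f p) (≈⇒rel (Algebra.sym B (homo f _))))
    }
    where
    open Hom φ
    open Congruence Θ
    module E = IsEquivalence isEquivalence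

  -- The two inclusions are exactly well-definedness and injectivity of the induced map.
  quotientEmbedding : {A B : Algebra 𝑆} (φ : Hom A B) {θ : Congruence A} {Θ : Congruence B} →
                      θ ≐ᶜ preimage φ Θ → Embedding (A / θ) (B / Θ)
  quotientEmbedding φ {Θ = Θ} (θ⇒Θ , Θ⇒θ) = record
    { hom       = record
      { to   = to
      ; cong = θ⇒Θ
      ; homo = λ f xs → Congruence.≈⇒rel Θ (homo f xs)
      }
    ; injective = Θ⇒θ
    }
    where open Hom φ

  rel-resp : {A : Algebra 𝑆} (θ : Congruence A) → ∀ {x y x′ y′} → A [ x ≈ x′ ] → A [ y ≈ y′ ] →
             Congruence.rel θ x y → Congruence.rel θ x′ y′
  rel-resp {A} θ p q r = E.trans (≈⇒rel (Algebra.sym A p)) (E.trans r (≈⇒rel q))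
    where
    open Congruence θ
    module E = IsEquivalence isEquivalence

  ≅-image : {A B : Algebra 𝑆} (φ : Embedding A B) → A ≅ subalgebra B (image (Embedding.hom φ))
  ≅-image {A} {B} φ = record
    { hom       = record
      { to   = λ a → to a , a , B.refl
      ; cong = cong
      ; homo = homo
      }
    ; bijective = injective , λ (b , a , φa≈b) → a , λ z≈a → B.trans (cong z≈a) φa≈b
    }
    where
    open Embedding φ
    module B = Algebra B

  ≅-refl : {A : Algebra 𝑆} → A ≅ A
  ≅-refl {A} = record
    { hom       = record { to = id ; cong = id ; homo = λ _ _ → Algebra.refl A }
    ; bijective = id , λ y → y , id
    }

  ⟨_⟩ : {A : Algebra 𝑆} {I : Set ℓ} {D : I → Algebra 𝑆} → (∀ i → Hom A (D i)) → Hom A (Π D)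
  ⟨ f ⟩ = record
    { to   = λ a i → Hom.to (f i) a
    ; cong = λ p i → Hom.cong (f i) p
    ; homo = λ o xs i → Hom.homo (f i) o xs
    }

  -- Congruences along an embedding, and essentiality.

  module _ {A C : Algebra 𝑆} (φ : Embedding A C) where
    open Embedding φ
    private
      module C = Algebra C

    -- An element of the image carries a chosen preimage, and these choices are compared;
    -- injectivity makes the relation respect the equality of `C`.
    imageCongruence : Congruence A → Congruence (subalgebra C (image hom))
    imageCongruence θ = record
      { rel           = λ (_ , a , _) (_ , a′ , _) → rel a a′
      ; ≈⇒rel         = λ {(_ , _ , p)} {(_ , _ , q)} c≈c′ →
          ≈⇒rel (injective (C.trans p (C.trans c≈c′ (C.sym q))))
      ; isEquivalence = record { refl = E.refl ; sym = E.sym ; trans = E.trans }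
      ; compatible    = λ f p → compatible f p
      }
      where
      open Congruence θ
      module E = IsEquivalence isEquivalence

    extendAlong : ∀ {k} {K : Pred (Algebra 𝑆) k} → CongruenceExtensionProperty K → C ∈ K →
                  (θ : Congruence A) → ∃[ Ψ ] θ ≐ᶜ preimage hom Ψ
    extendAlong cep C∈K θ =
      let Ψ , to-θ , from-θ = cep C∈K (image hom) (imageCongruence θ)
      in Ψ , (λ {a} {a′} p → from-θ {to a , a , C.refl} {to a′ , a′ , C.refl} p)
           , (λ {a} {a′} p → to-θ {to a , a , C.refl} {to a′ , a′ , C.refl} p)

    -- Essentiality in contrapositive, negation-free form. Recovering it from `IsEssential` takes
    -- excluded middle.
    DetectsΔ : Set (lsuc ℓ)
    DetectsΔ = (Θ : Congruence C) → Congruence.rel (preimage hom Θ) ⇒ Algebra._≈_ A →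
               Congruence.rel Θ ⇒ Algebra._≈_ C

    detectsΔ⇒essential : DetectsΔ → IsEssential φ
    detectsΔ⇒essential ess Θ Θ≠Δ (Θ⇒Δ , _) =
      Θ≠Δ (ess Θ (λ {a} {a′} p → injective (Θ⇒Δ {to a , a , C.refl} {to a′ , a′ , C.refl} p))
          , Congruence.≈⇒rel Θ)

    essential⇒detectsΔ : ExcludedMiddle ℓ → IsEssential φ → DetectsΔ
    essential⇒detectsΔ em ess Θ trivial = proj₁ (decidable-stable em λ Θ≠Δ →
      ess Θ Θ≠Δ
        ( (λ {(_ , a , p)} {(_ , a′ , q)} r → C.trans (C.sym p) (C.trans
            (cong (trivial (rel-resp Θ (C.sym p) (C.sym q) r))) q))
        , Congruence.≈⇒rel Θ))

    -- Injectivity makes the pulled-back congruences meet in the least congruence of `A`. Hence one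
    -- of them is trivial, and essentiality carries this back to `C`.
    essentialExtension-FSI : DetectsΔ → IsFSI A → IsFSI C
    essentialExtension-FSI ess A-FSI θ (_ , ⋂⇒Δ) =
      let i , _ , θi⇒Δ = A-FSI (preimage hom ∘ θ)
                           ( (λ a≈a′ i → Congruence.≈⇒rel (θ i) (cong a≈a′))
                           , injective ∘ ⋂⇒Δ)
      in i , Congruence.≈⇒rel (θ i) , ess (θ i) θi⇒Δ

  -- Closure operators, and amalgams as products of cocones.

  module _ {k : Level} {K : Pred (Algebra 𝑆) k} where

    𝕊-embedding : {A B : Algebra 𝑆} → Embedding A B → B ∈ K → A ∈ 𝕊 K
    𝕊-embedding {B = B} φ B∈K = B , B∈K , image (Embedding.hom φ) , ≅-image φ

    ⊆ℍ : K ⊆ ℍ K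
    ⊆ℍ {A} A∈K = A , A∈K , _≅_.hom (≅-refl {A}) , λ y → y , id

    ℍ-quotient : {A : Algebra 𝑆} (θ : Congruence A) → A ∈ K → A / θ ∈ ℍ K
    ℍ-quotient {A} θ A∈K = A , A∈K , quotientMap A θ , λ y → y , Congruence.≈⇒rel θ

    ℙ-product : {I : Set ℓ} {D : I → Algebra 𝑆} → (∀ i → D i ∈ K) → Π D ∈ ℙ K
    ℙ-product {I} {D} D∈K = I , D , D∈K , ≅-refl {Π D}

    swapSpan : Span K → Span K
    swapSpan s = record { A∈K = A∈K ; B∈K = C∈K ; C∈K = B∈K ; φ₁ = φ₂ ; φ₂ = φ₁ }
      where open Span s

    -- An amalgam stripped of injectivity: a single cocone may collapse points, since only a family
    -- of cocones has to separate them jointly.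
    record Cocone (s : Span K) : Set (lsuc ℓ ⊔ k) where
      open Span s
      field
        {D}      : Algebra 𝑆
        D∈K      : D ∈ K
        f        : Hom B D
        g        : Hom C D
        commutes : ∀ a → D [ Hom.to f (Embedding.to φ₁ a) ≈ Hom.to g (Embedding.to φ₂ a) ]

    swapCocone : {s : Span K} → Cocone (swapSpan s) → Cocone s
    swapCocone c = record { D∈K = D∈K ; f = g ; g = f ; commutes = Algebra.sym D ∘ commutes }
      where open Cocone c

    SeparatesLeft : Span K → Set (lsuc ℓ ⊔ k)
    SeparatesLeft s = ∀ {b b′} → ¬ B [ b ≈ b′ ] →
                      Σ[ c ∈ Cocone s ] ¬ Cocone.D c [ Hom.to (Cocone.f c) b ≈ Hom.to (Cocone.f c) b′ ]
      where open Span s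

    -- In the product over all distinct pairs, each pair is separated at the coordinate that it
    -- indexes.
    separated⇒amalgam : ExcludedMiddle ℓ → ℙ K ⊆ K → (s : Span K) →
                        SeparatesLeft s → SeparatesLeft (swapSpan s) → Amalgam K s
    separated⇒amalgam em ℙ-closed s left right = record
      { D∈K      = ℙ-closed (ℙ-product (Cocone.D∈K ∘ cocone))
      ; ψ₁       = record
        { hom       = ⟨ Cocone.f ∘ cocone ⟩
        ; injective = λ p → decidable-stable em λ b≉b′ →
            proj₂ (left b≉b′) (p (inj₁ (_ , _ , b≉b′)))
        }
      ; ψ₂       = record
        { hom       = ⟨ Cocone.g ∘ cocone ⟩
        ; injective = λ p → decidable-stable em λ c≉c′ →
            proj₂ (right c≉c′) (p (inj₂ (_ , _ , c≉c′)))
        }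
      ; commutes = λ a i → Cocone.commutes (cocone i) a
      }
      where
      open Span s

      -- Indexing by pairs keeps the index set at level `ℓ`, as `Π` requires. If there are no such
      -- pairs, the product is trivial.
      Distinct : Algebra 𝑆 → Set ℓ
      Distinct X = ∃[ x ] ∃[ y ] ¬ X [ x ≈ y ]

      cocone : Distinct B ⊎ Distinct C → Cocone s
      cocone (inj₁ (_ , _ , b≉b′)) = proj₁ (left b≉b′)
      cocone (inj₂ (_ , _ , c≉c′)) = swapCocone {s} (proj₁ (right c≉c′))

-- Maximal congruences and the quotients they yield.

module _ (em : ∀ {a} → ExcludedMiddle a) (zorn : ∀ {a ℓ₁ ℓ₂} → ZornsLemma a ℓ₁ ℓ₂) where

  -- A union of congruences lives one universe too high to be a
  -- congruence; excluded middle brings it back down.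

  Resize : ∀ {p} (ℓ : Level) → Set p → Set ℓ
  Resize ℓ P = Lift ℓ (True (em {P = P}))

  module _ {ℓ p : Level} {P : Set p} where

    resize : P → Resize ℓ P
    resize x = lift (fromWitness x)

    unresize : Resize ℓ P → P
    unresize (lift w) = toWitness w

  module _ {ℓ : Level} {𝑆 : Signature ℓ} where

    module _ {A : Algebra 𝑆} (R : Rel (Algebra.Carrier A) ℓ) where
      open Congruence using (rel)

      module _ (Ψ₀ : Congruence A) (Ψ₀⊆R : rel Ψ₀ ⇒ R) where

        Between : Set (lsuc ℓ)
        Between = Σ[ Ψ ∈ Congruence A ] (rel Ψ₀ ⇒ rel Ψ) × (rel Ψ ⇒ R)

        betweenPoset : Poset (lsuc ℓ) ℓ ℓ
        betweenPoset = record
          { Carrier        = Between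
          ; _≈_            = λ (Ψ , _) (Φ , _) → Ψ ≐ᶜ Φ
          ; _≤_            = λ (Ψ , _) (Φ , _) → rel Ψ ⇒ rel Φ
          ; isPartialOrder = record
            { isPreorder = record
              { isEquivalence = record
                { refl  = id , id
                ; sym   = λ (p , q) → q , p
                ; trans = λ (p , q) (p′ , q′) → (λ x → p′ (p x)) , (λ x → q (q′ x))
                }
              ; reflexive     = proj₁
              ; trans         = λ p q x → q (p x)
              }
            ; antisym    = λ p q → p , q
            }
          }

        module _ (𝒞 : Pred Between (lsuc ℓ)) (chain : IsChain betweenPoset 𝒞) where
          open Poset betweenPoset using (_≤_)

          bottom : Between
          bottom = Ψ₀ , id , Ψ₀⊆R

          -- Adjoining the bottom element makes the chain non-empty.

          𝒞⊥ : Pred Between (lsuc ℓ)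
          𝒞⊥ Ψ = Ψ ∈ 𝒞 ⊎ Ψ ≡ bottom

          chain⊥ : IsChain betweenPoset 𝒞⊥
          chain⊥ (inj₁ p) (inj₁ q) = chain p q
          chain⊥ {y = _ , Ψ₀⊆Φ , _} (inj₂ refl) _ = inj₁ Ψ₀⊆Φ
          chain⊥ {x = _ , Ψ₀⊆Φ , _} _ (inj₂ refl) = inj₂ Ψ₀⊆Φ

          Related : Rel (Algebra.Carrier A) (lsuc ℓ)
          Related x y = ∃[ Ψ ] Ψ ∈ 𝒞⊥ × rel (proj₁ Ψ) x y

          common : ∀ {Ψ Φ} → Ψ ∈ 𝒞⊥ → Φ ∈ 𝒞⊥ → ∃[ Ξ ] Ξ ∈ 𝒞⊥ × Ψ ≤ Ξ × Φ ≤ Ξ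
          common Ψ∈𝒞 Φ∈𝒞 with chain⊥ Ψ∈𝒞 Φ∈𝒞
          ... | inj₁ Ψ≤Φ = _ , Φ∈𝒞 , Ψ≤Φ , id
          ... | inj₂ Φ≤Ψ = _ , Ψ∈𝒞 , id , Φ≤Ψ

          -- Arities are finite, so one member of the chain relates all arguments at once; this
          -- makes the union compatible with the operations.
          commonFin : ∀ {n} {xs ys : Fin n → Algebra.Carrier A} → (∀ i → Related (xs i) (ys i)) →
                      ∃[ Ψ ] Ψ ∈ 𝒞⊥ × (∀ i → rel (proj₁ Ψ) (xs i) (ys i))
          -- Some member is needed even if `𝒞` is empty; the adjoined bottom serves.
          commonFin {zero}  p = bottom , inj₂ refl , λ ()
          commonFin {suc n} p =
            let Ψ , Ψ∈𝒞 , r  = p zero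
                Φ , Φ∈𝒞 , rs = commonFin (p ∘ suc)
                Ξ , Ξ∈𝒞 , Ψ≤Ξ , Φ≤Ξ = common Ψ∈𝒞 Φ∈𝒞
            in Ξ , Ξ∈𝒞 , λ { zero → Ψ≤Ξ r ; (suc i) → Φ≤Ξ (rs i) }

          union : Congruence A
          union = record
            { rel           = λ x y → Resize ℓ (Related x y)
            ; ≈⇒rel         = λ x≈y →
                resize (bottom , inj₂ refl , Congruence.≈⇒rel Ψ₀ x≈y)
            ; isEquivalence = record
              { refl  = resize (bottom , inj₂ refl , IsEquivalence.refl (Congruence.isEquivalence Ψ₀))
              ; sym   = λ p → let Ψ , Ψ∈𝒞 , r = unresize p in
                  resize (Ψ , Ψ∈𝒞 , IsEquivalence.sym (Congruence.isEquivalence (proj₁ Ψ)) r)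
              ; trans = λ p q →
                  let Ψ , Ψ∈𝒞 , r = unresize p
                      Φ , Φ∈𝒞 , s = unresize q
                      Ξ , Ξ∈𝒞 , Ψ≤Ξ , Φ≤Ξ = common Ψ∈𝒞 Φ∈𝒞
                  in resize (Ξ , Ξ∈𝒞 ,
                       IsEquivalence.trans (Congruence.isEquivalence (proj₁ Ξ)) (Ψ≤Ξ r) (Φ≤Ξ s))
              }
            ; compatible    = λ f p →
                let Ψ , Ψ∈𝒞 , r = commonFin (λ i → unresize (p i))
                in resize (Ψ , Ψ∈𝒞 , Congruence.compatible (proj₁ Ψ) f r)
            }

          chainBounded : ∃ (IsUpperBound betweenPoset 𝒞)
          chainBounded =
              ( union
              , (λ r → resize (bottom , inj₂ refl , r))
              , (λ p → let (_ , _ , Ψ⊆R) , _ , r = unresize p in Ψ⊆R r))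
            , λ {Ψ} Ψ∈𝒞 r → resize (Ψ , inj₁ Ψ∈𝒞 , r)

        -- Any relation can serve as `R`, because inclusion in it is checked pair by pair and so
        -- survives unions of chains. This covers both bounding the trace on a subalgebra and
        -- avoiding a pair.
        maximalCongruence : ∃[ Ψ ] (rel Ψ₀ ⇒ rel Ψ) × (rel Ψ ⇒ R) ×
          ((Φ : Congruence A) → rel Ψ ⇒ rel Φ → rel Φ ⇒ R → rel Φ ⇒ rel Ψ)
        maximalCongruence =
          let (Ψ , Ψ₀⊆Ψ , Ψ⊆R) , max = zorn betweenPoset chainBounded
          in Ψ , Ψ₀⊆Ψ , Ψ⊆R , λ Φ Ψ⊆Φ Φ⊆R →
               proj₁ (max {Φ , (λ r → Ψ⊆Φ (Ψ₀⊆Ψ r)) , Φ⊆R} Ψ⊆Φ)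

    -- Lying above `Ψ₀` keeps the trace of `Ψ` at least `θ`, and `R` keeps it at most `θ`. A
    -- congruence of `C / Ψ` that is trivial on `A / θ`, viewed on `C`, still lies in `R`, so
    -- maximality puts it inside `Ψ`.
    essentialQuotient :
      {A C : Algebra 𝑆} (φ : Embedding A C) (θ : Congruence A) (Ψ₀ : Congruence C) →
      θ ≐ᶜ preimage (Embedding.hom φ) Ψ₀ →
      ∃[ Ψ ] Σ[ eq ∈ θ ≐ᶜ preimage (Embedding.hom φ) Ψ ]
        DetectsΔ (quotientEmbedding (Embedding.hom φ) {θ} {Ψ} eq)
    essentialQuotient {A} {C} φ θ Ψ₀ (θ⇒Ψ₀ , Ψ₀⇒θ) =
      let Ψ , Ψ₀⊆Ψ , Ψ⊆R , max = maximalCongruence R Ψ₀ Ψ₀⊆R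
      in Ψ , ((λ r → Ψ₀⊆Ψ (θ⇒Ψ₀ r)) , (λ r → Ψ⊆R r C.refl C.refl))
           , λ Θ trivial → let Θ′ = preimage (quotientMap C Ψ) Θ in
               max Θ′ (Congruence.≈⇒rel Θ) λ r p q →
                 trivial (rel-resp Θ′ p q r)
      where
      open Embedding φ
      module C = Algebra C

      -- Vacuous for pairs outside the image, so only the trace on `A` is bounded.
      R : Rel C.Carrier ℓ
      R x y = ∀ {a a′} → C [ x ≈ to a ] → C [ y ≈ to a′ ] → Congruence.rel θ a a′

      Ψ₀⊆R : Congruence.rel Ψ₀ ⇒ R
      Ψ₀⊆R r p q = Ψ₀⇒θ (rel-resp Ψ₀ p q r)

    -- If congruences above `Θ` intersect in `Θ`, one of them omits `(b , b′)`, and maximality makes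
    -- that one equal to `Θ`.
    maximalAvoiding : {B : Algebra 𝑆} {b b′ : Algebra.Carrier B} → ¬ B [ b ≈ b′ ] →
                      ∃[ Θ ] (¬ Congruence.rel Θ b b′) × IsFSI (B / Θ)
    maximalAvoiding {B} {b} {b′} b≉b′ =
      let Θ , _ , Θ⊆R , max = maximalCongruence R (Δ B) Δ⊆R
      in Θ , (λ r → Θ⊆R r B.refl B.refl) , λ θ (_ , ⋂⇒Δ) →
        let b≉ᵢb′ : ∃[ i ] ¬ Congruence.rel (θ i) b b′
            b≉ᵢb′ = decidable-stable em λ none → Θ⊆R
              (⋂⇒Δ λ i → decidable-stable em λ r → none (i , r)) B.refl B.refl
            i , ¬r = b≉ᵢb′
            θᵢ = preimage (quotientMap B Θ) (θ i)
        in i , Congruence.≈⇒rel (θ i)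
             , max θᵢ (Congruence.≈⇒rel (θ i)) λ r p q → ¬r (rel-resp θᵢ p q r)
      where
      module B = Algebra B

      R : Rel B.Carrier ℓ
      R x y = B [ x ≈ b ] → B [ y ≈ b′ ] → ⊥

      Δ⊆R : B._≈_ ⇒ R
      Δ⊆R x≈y p q = b≉b′ (B.trans (B.sym p) (B.trans x≈y q))

    -- Transfer of amalgamation between a variety and its finitely subdirectly irreducible members.

    module _ {v : Level} (V : Pred (Algebra 𝑆) v) (var : IsVariety V) where
      open IsVariety var

      AP⇒FSI-EAP : AmalgamationProperty V → EssentialAmalgamationProperty (FSI V)
      AP⇒FSI-EAP ap s φ₂-essential = record
        { D∈K      = ℍ-closed (ℍ-quotient Θ D∈V) ,
                     essentialExtension-FSI ψ₁/Θ Θ-detects (proj₂ B∈K)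
        ; ψ₁       = record { hom = quotientMap D Θ ∘ʰ Embedding.hom ψ₁ ; injective = proj₂ Θ∩B²≐Δ }
        ; ψ₂       = record
          { hom       = quotientMap D Θ ∘ʰ Embedding.hom ψ₂
          -- By essentiality only points coming from `A` matter; commutativity moves them into `B`,
          -- where `Θ` is trivial.
          ; injective = essential⇒detectsΔ φ₂ em φ₂-essential (preimage (Embedding.hom ψ₂) Θ)
              λ r → Embedding.injective φ₁
                (proj₂ Θ∩B²≐Δ (rel-resp Θ (D.sym (commutes _)) (D.sym (commutes _)) r))
          }
        ; commutes = λ a → Congruence.≈⇒rel Θ (commutes a)
        }
        where
        open Span s

        spanInV : Span V
        spanInV = record
          { A∈K = proj₁ A∈K ; B∈K = proj₁ B∈K ; C∈K = proj₁ C∈K ; φ₁ = φ₁ ; φ₂ = φ₂ }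

        amalgam : Amalgam V spanInV
        amalgam = ap spanInV

        open Amalgam amalgam renaming (D∈K to D∈V)
        module D = Algebra D

        -- `B / Δ B` is `B` by eta, so the resulting essential embedding starts at `B` itself.
        quotient  = essentialQuotient ψ₁ (Δ B) (Δ D) (Embedding.cong ψ₁ , Embedding.injective ψ₁)
        Θ         = proj₁ quotient
        Θ∩B²≐Δ    = proj₁ (proj₂ quotient)
        Θ-detects = proj₂ (proj₂ quotient)

        ψ₁/Θ = quotientEmbedding (Embedding.hom ψ₁) {Δ B} {Θ} Θ∩B²≐Δ

      module _ (cep : CongruenceExtensionProperty V)
               (𝕊-FSI : 𝕊 (FSI V) ⊆ FSI V)
               (eap : EssentialAmalgamationProperty (FSI V)) where

        separatesLeft : (s : Span V) → SeparatesLeft s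
        separatesLeft s b≉b′ = record
          { D∈K      = proj₁ (Amalgam.D∈K amalgam)
          ; f        = Embedding.hom (Amalgam.ψ₁ amalgam) ∘ʰ quotientMap B Θ
          ; g        = Embedding.hom (Amalgam.ψ₂ amalgam) ∘ʰ quotientMap C Ψ
          ; commutes = Amalgam.commutes amalgam
          } , λ r → b≉ᶿb′ (Embedding.injective (Amalgam.ψ₁ amalgam) r)
          where
          open Span s
          avoiding = maximalAvoiding {B} b≉b′
          Θ       = proj₁ avoiding
          b≉ᶿb′   = proj₁ (proj₂ avoiding)
          B/Θ∈FSI : B / Θ ∈ FSI V
          B/Θ∈FSI = ℍ-closed (ℍ-quotient Θ B∈K) , proj₂ (proj₂ avoiding)

          θ : Congruence A
          θ = preimage (Embedding.hom φ₁) Θ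

          φ₁/Θ : Embedding (A / θ) (B / Θ)
          φ₁/Θ = quotientEmbedding (Embedding.hom φ₁) {θ} {Θ} (id , id)

          A/θ∈FSI : A / θ ∈ FSI V
          A/θ∈FSI = 𝕊-FSI (𝕊-embedding φ₁/Θ B/Θ∈FSI)

          extension = extendAlong φ₂ cep C∈K θ
          quotient  = essentialQuotient φ₂ θ (proj₁ extension) (proj₂ extension)
          Ψ         = proj₁ quotient
          Ψ-detects = proj₂ (proj₂ quotient)

          φ₂/Ψ : Embedding (A / θ) (C / Ψ)
          φ₂/Ψ = quotientEmbedding (Embedding.hom φ₂) {θ} {Ψ} (proj₁ (proj₂ quotient))

          amalgam = eap
            record
              { A∈K = A/θ∈FSI
              ; B∈K = B/Θ∈FSI
              -- Irreducibility goes down from `B / Θ` to its subalgebra `A / θ`, then up to the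
              -- essential extension `C / Ψ`.
              ; C∈K = ℍ-closed (ℍ-quotient Ψ C∈K) ,
                      essentialExtension-FSI φ₂/Ψ Ψ-detects (proj₂ A/θ∈FSI)
              ; φ₁  = φ₁/Θ
              ; φ₂  = φ₂/Ψ
              }
            (detectsΔ⇒essential φ₂/Ψ Ψ-detects)

        FSI-EAP⇒AP : AmalgamationProperty V
        FSI-EAP⇒AP s = separated⇒amalgam em ℙ-closed s
          (separatesLeft s) (separatesLeft (swapSpan s))

proposition3p4 : (∀ {a} → ExcludedMiddle a) →
    (∀ {a ℓ₁ ℓ₂} → ZornsLemma a ℓ₁ ℓ₂) →
    ∀ {ℓ v} (𝑆 : Signature ℓ) (V : Pred (Algebra 𝑆) v) →
    IsVariety V →
    CongruenceExtensionProperty V →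
    ℍ (𝕊 (FSI V)) ≐ FSI V →
    AmalgamationProperty V ⇔ EssentialAmalgamationProperty (FSI V)
proposition3p4 em zorn 𝑆 V var cep (ℍ𝕊-FSI , _) = mk⇔
  (AP⇒FSI-EAP em zorn V var)
  -- Every algebra is a quotient of itself, so closure under `𝕊` follows from closure under `ℍ`
  -- after `𝕊`.
  (FSI-EAP⇒AP em zorn V var cep (ℍ𝕊-FSI ∘ ⊆ℍ))
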